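{- There is a CNF encoding of $\mathsf{AtMostOne}(x_1,\dots,x_n)$ using $2n + 2\sqrt{2n} + \widetilde{O}(\sqrt[4]{n})$ clauses and $\sqrt{2n} + \widetilde{O}(\sqrt[4]{n})$ auxiliary variables.
   Context: $\mathsf{AtMostOne}(x_1,\dots,x_n)$ is true iff at most one of $x_1,\dots,x_n$ is true. $\widetilde{O}(g)$ denotes $O(g\cdot \log^{c} n)$ for some constant $c$. A CNF formula is a set of clauses; its size is its number of clauses. For a partial assignment $\tau$, $\varphi|_\tau$ deletes clauses satisfied by $\tau$ and literals falsified by $\tau$. A CNF $\varphi$ over $X\sqcup Y$, $X=(x_1,\dots,x_n)$, encodes $f$ if for every assignment $\tau$ of $X$, $f(\tau)=\top$ iff $\varphi|_\tau$ is satisfiable; variables in $Y$ are auxiliary. -}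

module Defs where

open import Data.Nat using (ℕ; zero; suc; _+_; _*_; _^_; _≤_; _≤?_)
open import Data.Nat.Logarithm using (⌈log₂_⌉)
open import Data.Bool using (Bool; true; false; not)
open import Data.Fin using (Fin)
open import Data.Sum using (_⊎_; inj₁; inj₂)
open import Data.List using (List; length)
open import Data.List.Relation.Unary.All using (All)
open import Data.List.Relation.Unary.Any using (Any)
open import Data.Product using (Σ; _×_)
open import Relation.Binary.PropositionalEquality using (_≡_)
open import Relation.Nullary using (yes; no)

-- Variables: input variables X = Fin n (inj₁) and auxiliary variables Y = Fin m (inj₂).
Var : ℕ → ℕ → Set
Var n m = Fin n ⊎ Fin m

record Literal (n m : ℕ) : Set where
  constructor lit
  field
    polarity : Bool
    var      : Var n m

Clause : ℕ → ℕ → Set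
Clause n m = List (Literal n m)

CNF : ℕ → ℕ → Set
CNF n m = List (Clause n m)

size : ∀ {n m} → CNF n m → ℕ
size = length

assign : ∀ {n m} → (Fin n → Bool) → (Fin m → Bool) → Var n m → Bool
assign τ σ (inj₁ i) = τ i
assign τ σ (inj₂ j) = σ j

litVal : ∀ {n m} → (Var n m → Bool) → Literal n m → Bool
litVal α (lit true v)  = α v
litVal α (lit false v) = not (α v)

SatClause : ∀ {n m} → (Var n m → Bool) → Clause n m → Set
SatClause α C = Any (λ l → litVal α l ≡ true) C

SatCNF : ∀ {n m} → (Var n m → Bool) → CNF n m → Set
SatCNF α φ = All (SatClause α) φ

AtMostOne : ∀ {n} → (Fin n → Bool) → Set
AtMostOne {n} τ = ∀ (i j : Fin n) → τ i ≡ true → τ j ≡ true → i ≡ j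

Encodes : ∀ {n m} → ((Fin n → Bool) → Set) → CNF n m → Set
Encodes {n} {m} f φ =
  ∀ (τ : Fin n → Bool) →
    (f τ → Σ (Fin m → Bool) (λ σ → SatCNF (assign τ σ) φ)) ×
    (Σ (Fin m → Bool) (λ σ → SatCNF (assign τ σ) φ) → f τ)

-- ceilRoot k x = least r with x ≤ r ^ k, i.e. ⌈ x^(1/k) ⌉ (for k ≥ 1).
-- Search r = 0,1,2,... with fuel x + 1 (r = x always works for k ≥ 1).
rootSearch : ℕ → ℕ → ℕ → ℕ → ℕ
rootSearch k x r zero = r
rootSearch k x r (suc fuel) with x ≤? r ^ k
... | yes _ = r
... | no  _ = rootSearch k x (suc r) fuel

ceilRoot : ℕ → ℕ → ℕ
ceilRoot k x = rootSearch k x 0 (suc x)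

ceilSqrt : ℕ → ℕ
ceilSqrt = ceilRoot 2

ceilRoot4 : ℕ → ℕ
ceilRoot4 = ceilRoot 4

-- The error term C · ⌈n^(1/4)⌉ · ⌈log₂ n⌉^c of a function in Õ(n^(1/4)).
softErr : ℕ → ℕ → ℕ → ℕ
softErr C c n = C * ceilRoot4 n * (⌈log₂ n ⌉ ^ c)

{-# OPTIONS --safe #-}

-- Arrange p² auxiliary variables in a p × p grid and let the input variables be edges
-- joining two cells that differ both in their row and in their column; there are about
-- p⁴/2 such edges, so p² ≈ √(2n) suffices. A true edge forces its two end cells, so it
-- remains to forbid three or more true cells. For this, rows r₁ ≠ r₂ and columns c₁ ≠ c₂
-- are guessed (O(p) variables and clauses), and every true cell (r , c) must satisfy
--   (r = r₁ ∨ c = c₂) ∧ (c = c₁ ∨ r = r₂).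
-- These two clauses per cell leave exactly the cells (r₁ , c₁) and (r₂ , c₂), since the
-- mixed cases would give r₁ = r₂ or c₁ = c₂.

module Submission where

open import Defs
open import Data.Nat using (ℕ; _+_; _*_; _≤_)
open import Data.Product using (Σ; _×_)

open import Data.Bool using (Bool; true; false; not)
import Data.Bool.Properties as Boolₚ
open import Data.Fin.Base as Fin
  using (Fin; zero; suc; toℕ; inject₁; inject≤; punchIn; splitAt; remQuot; join; combine)
open import Data.Fin.Induction using (<-weakInduction)
import Data.Fin.Properties as Finₚ
open import Data.List using ([]; _∷_; tabulate)
open import Data.List.Properties using (length-tabulate)
open import Data.List.Relation.Unary.All.Properties using (tabulate⁺; tabulate⁻)
open import Data.List.Relation.Unary.Any using (here; there)
open import Data.Nat.Base using (zero; suc; s≤s; s≤s⁻¹; z≤n; z<s; _<_; _^_; >-nonZero)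
open import Data.Nat.Properties
open import Data.Nat.Tactic.RingSolver using (solve-∀)
open import Data.Product using (_,_; proj₁; proj₂; uncurry)
open import Data.Product.Function.NonDependent.Propositional using (_×-↔_)
open import Data.Product.Properties using (≡-dec; ,-injectiveˡ; ,-injectiveʳ)
open import Data.Sum using (_⊎_; inj₁; inj₂)
open import Data.Sum.Function.Propositional using (_⊎-↔_)
open import Function using (_∘_; _↔_; Inverse)
open import Function.Properties.Inverse using (↔-refl; ↔-trans)
open import Relation.Binary.Definitions using (tri<; tri≈; tri>)
open import Relation.Binary.PropositionalEquality
  using (_≡_; _≢_; refl; sym; trans; cong; cong₂; subst; module ≡-Reasoning)
open import Relation.Nullary using (¬_; Dec; yes; no; does; contradiction)
open import Relation.Nullary.Decidable using (dec-true; _⊎-dec_)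

private
  variable
    n m p : ℕ

-- Ceiling roots.

rootSearch-sound : ∀ k x r fuel → x ≤ (r + fuel) ^ k → x ≤ rootSearch k x r fuel ^ k
rootSearch-sound k x r zero       h = subst (λ t → x ≤ t ^ k) (+-identityʳ r) h
rootSearch-sound k x r (suc fuel) h with x ≤? r ^ k
... | yes q = q
... | no  _ = rootSearch-sound k x (suc r) fuel (subst (λ t → x ≤ t ^ k) (+-suc r fuel) h)

-- `r ≤ t` is the search invariant: a failed test at `r` rules out `t = r`.
rootSearch-least : ∀ k x r fuel {t} → r ≤ t → x ≤ t ^ k → rootSearch k x r fuel ≤ t
rootSearch-least k x r zero       r≤t h = r≤t
rootSearch-least k x r (suc fuel) r≤t h with x ≤? r ^ k
... | yes _ = r≤t
... | no ¬q = rootSearch-least k x (suc r) fuel (≤∧≢⇒< r≤t λ { refl → ¬q h }) h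

-- The fuel lets the search reach `suc x`, and a positive exponent gives `x ≤ suc x ^ suc k` there.
ceilRoot-sound : ∀ k x → x ≤ ceilRoot (suc k) x ^ suc k
ceilRoot-sound k x = rootSearch-sound (suc k) x 0 (suc x)
  (≤-trans (n≤1+n x) (m≤m*n (suc x) (suc x ^ k) ⦃ m^n≢0 (suc x) k ⦄))

ceilRoot-least : ∀ k x {t} → x ≤ t ^ k → ceilRoot k x ≤ t
ceilRoot-least k x = rootSearch-least k x 0 (suc x) z≤n

-- If the root is `suc t`, minimality gives `t ^ 2 < x`; passing from `t ^ 2` to the next square
-- adds only a linear term.
ceilSqrt-square≤ : ∀ x → ceilSqrt x * ceilSqrt x ≤ x + 2 * ceilSqrt x
ceilSqrt-square≤ x = go (ceilSqrt x) (λ t → ceilRoot-least 2 x {t})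
  where
  go : ∀ q → (∀ t → x ≤ t ^ 2 → q ≤ t) → q * q ≤ x + 2 * q
  go zero    _     = z≤n
  go (suc t) least = begin
    suc t * suc t      ≡⟨ expand t ⟩
    suc (t ^ 2) + 2 * t ≤⟨ +-mono-≤ (≰⇒> (1+n≰n ∘ least t)) (*-monoʳ-≤ 2 (n≤1+n t)) ⟩
    x + 2 * suc t      ∎
    where
    open ≤-Reasoning
    expand : ∀ t → suc t * suc t ≡ suc (t * (t * 1)) + 2 * t
    expand = solve-∀

-- Edges of the grid.

Cell : ℕ → Set
Cell p = Fin p × Fin p

-- The binomial coefficient p choose 2, in the recursive form that `increasing` follows.
triangular : ℕ → ℕ
triangular zero    = 0
triangular (suc p) = triangular p + p

2*triangular : ∀ q → 2 * triangular (suc q) ≡ suc q * q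
2*triangular zero    = refl
2*triangular (suc q) = begin
  2 * (triangular (suc q) + suc q)   ≡⟨ *-distribˡ-+ 2 (triangular (suc q)) (suc q) ⟩
  2 * triangular (suc q) + 2 * suc q ≡⟨ cong (_+ 2 * suc q) (2*triangular q) ⟩
  suc q * q + 2 * suc q              ≡⟨ collect q ⟩
  suc (suc q) * suc q                ∎
  where
  open ≡-Reasoning
  collect : ∀ q → suc q * q + 2 * suc q ≡ suc (suc q) * suc q
  collect = solve-∀

-- Enumerates all pairs `a < b`: the last `p` indices give those with `a = 0`, the others are
-- shifted from the smaller case.
increasing : ∀ p → Fin (triangular p) → Fin p × Fin p
increasing (suc p) i with splitAt (triangular p) i
... | inj₁ j = let a , b = increasing p j in suc a , suc b
... | inj₂ b = zero , suc b

increasing-< : ∀ p i → proj₁ (increasing p i) Fin.< proj₂ (increasing p i)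
increasing-< (suc p) i with splitAt (triangular p) i
... | inj₁ j = s≤s (increasing-< p j)
... | inj₂ b = z<s

increasing-injective : ∀ p i j → increasing p i ≡ increasing p j → i ≡ j
increasing-injective (suc p) i j eq =
  trans (sym (Finₚ.join-splitAt t p i)) (trans (cong (join t p) (go eq)) (Finₚ.join-splitAt t p j))
  where
  t = triangular p
  go : increasing (suc p) i ≡ increasing (suc p) j → splitAt t i ≡ splitAt t j
  go eq with splitAt t i | splitAt t j
  ... | inj₁ a | inj₁ b = cong inj₁ (increasing-injective p a b
          (cong₂ _,_ (Finₚ.suc-injective (,-injectiveˡ eq)) (Finₚ.suc-injective (,-injectiveʳ eq))))
  ... | inj₂ a | inj₂ b = cong inj₂ (Finₚ.suc-injective (,-injectiveʳ eq))
  ... | inj₁ a | inj₂ b with () ← ,-injectiveˡ eq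
  ... | inj₂ a | inj₁ b with () ← ,-injectiveˡ eq

-- The condition `rows<` orients each edge, so that two edges can never join the same cells in
-- opposite directions.
record Edges (n p : ℕ) : Set where
  field
    src tgt   : Fin n → Cell p
    rows<     : ∀ e → proj₁ (src e) Fin.< proj₁ (tgt e)
    cols≢     : ∀ e → proj₂ (src e) ≢ proj₂ (tgt e)
    injective : ∀ {e f} → src e ≡ src f → tgt e ≡ tgt f → e ≡ f

-- All such edges in a grid of side `suc q`: increasing row pairs times ordered pairs of distinct
-- columns.
edgeCount : ℕ → ℕ
edgeCount q = triangular (suc q) * (suc q * q)

2*edgeCount : ∀ q → 2 * edgeCount q ≡ (suc q * q) ^ 2
2*edgeCount q = begin
  2 * (triangular (suc q) * d) ≡⟨ *-assoc 2 (triangular (suc q)) d ⟨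
  2 * triangular (suc q) * d   ≡⟨ cong (_* d) (2*triangular q) ⟩
  d * d                        ≡⟨ cong (d *_) (*-identityʳ d) ⟨
  d ^ 2                        ∎
  where
  open ≡-Reasoning
  d = suc q * q

gridEdges : ∀ q → Edges (edgeCount q) (suc q)
gridEdges q = record
  { src       = λ e → proj₁ (rows e) , col e
  -- `punchIn` skips the source column, so `gap e` ranges over exactly the `q` other columns.
  ; tgt       = λ e → proj₂ (rows e) , punchIn (col e) (gap e)
  ; rows<     = λ e → increasing-< (suc q) (pair e)
  ; cols≢     = λ e → Finₚ.punchInᵢ≢i (col e) (gap e) ∘ sym
  ; injective = λ {e} {f} → inj e f
  }
  where
  t = triangular (suc q)
  pair : Fin (edgeCount q) → Fin t
  pair e = proj₁ (remQuot {t} (suc q * q) e)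
  cols : Fin (edgeCount q) → Fin (suc q * q)
  cols e = proj₂ (remQuot {t} (suc q * q) e)
  rows : Fin (edgeCount q) → Fin (suc q) × Fin (suc q)
  rows e = increasing (suc q) (pair e)
  col : Fin (edgeCount q) → Fin (suc q)
  col e = proj₁ (remQuot {suc q} q (cols e))
  gap : Fin (edgeCount q) → Fin q
  gap e = proj₂ (remQuot {suc q} q (cols e))

  remQuot-injective : ∀ {a} b (i j : Fin (a * b)) → remQuot {a} b i ≡ remQuot {a} b j → i ≡ j
  remQuot-injective {a} b i j eq = begin
    i                                ≡⟨ Finₚ.combine-remQuot {a} b i ⟨
    uncurry combine (remQuot {a} b i) ≡⟨ cong (uncurry combine) eq ⟩
    uncurry combine (remQuot {a} b j) ≡⟨ Finₚ.combine-remQuot {a} b j ⟩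
    j                                ∎
    where open ≡-Reasoning

  inj : ∀ e f → (proj₁ (rows e) , col e) ≡ (proj₁ (rows f) , col f) →
        (proj₂ (rows e) , punchIn (col e) (gap e)) ≡ (proj₂ (rows f) , punchIn (col f) (gap f)) →
        e ≡ f
  inj e f eq₁ eq₂ = remQuot-injective {t} (suc q * q) e f (cong₂ _,_ pair≡ cols≡)
    where
    pair≡ : pair e ≡ pair f
    pair≡ = increasing-injective (suc q) (pair e) (pair f)
              (cong₂ _,_ (,-injectiveˡ eq₁) (,-injectiveˡ eq₂))
    col≡ : col e ≡ col f
    col≡ = ,-injectiveʳ eq₁
    gap≡ : gap e ≡ gap f
    gap≡ = Finₚ.punchIn-injective (col f) (gap e) (gap f)
             (subst (λ c → punchIn c (gap e) ≡ punchIn (col f) (gap f)) col≡ (,-injectiveʳ eq₂))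
    cols≡ : cols e ≡ cols f
    cols≡ = remQuot-injective {suc q} q (cols e) (cols f) (cong₂ _,_ col≡ gap≡)

restrict : n ≤ m → Edges m p → Edges n p
restrict n≤m E = record
  { src       = src ∘ ι
  ; tgt       = tgt ∘ ι
  ; rows<     = rows< ∘ ι
  ; cols≢     = cols≢ ∘ ι
  ; injective = λ eq₁ eq₂ → Finₚ.inject≤-injective n≤m n≤m _ _ (injective eq₁ eq₂)
  }
  where
  open Edges E
  ι = λ i → inject≤ i n≤m

-- Clauses as implications.

pos neg : Var n m → Literal n m
pos = lit true
neg = lit false

module _ {α : Var n m → Bool} where

  ⇒-intro : ∀ v {C} → (α v ≡ true → SatClause α C) → SatClause α (neg v ∷ C)
  ⇒-intro v f with α v in eq
  ... | true  = there (f refl)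
  ... | false = here (cong not eq)

  ⇒-elim : ∀ v {C} → SatClause α (neg v ∷ C) → α v ≡ true → SatClause α C
  ⇒-elim v (there c) h = c
  ⇒-elim v (here c)  h with () ← trans (sym (cong not h)) c

  unit-pos : ∀ {v} → SatClause α (pos v ∷ []) → α v ≡ true
  unit-pos (here h) = h

  unit-neg : ∀ v → SatClause α (neg v ∷ []) → ¬ α v ≡ true
  unit-neg v c h with () ← ⇒-elim v c h

-- Auxiliary variables and clauses.

-- Slots for the guessed rows and columns; the first cell is (row₁ , col₁).
pattern row₁ = zero
pattern row₂ = suc zero
pattern col₁ = suc (suc zero)
pattern col₂ = suc (suc (suc zero))

-- The thresholds of a slot run from 0 to `p`, hence `suc p` of them; they make uniqueness in a slot
-- cost linearly many clauses instead of quadratically many.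
Aux : ℕ → Set
Aux p = Cell p ⊎ (Fin 4 × (Fin p ⊎ Fin (suc p)))

-- "pick s i": slot s holds i.  "above s j": slot s holds an index below j.
pattern cell v    = inj₁ v
pattern pick s i  = inj₂ (s , inj₁ i)
pattern above s j = inj₂ (s , inj₂ j)

auxCount : ℕ → ℕ
auxCount p = p * p + 4 * (p + suc p)

Fin↔Aux : Fin (auxCount p) ↔ Aux p
Fin↔Aux = ↔-trans Finₚ.+↔⊎
  (Finₚ.*↔× ⊎-↔ ↔-trans Finₚ.*↔× (↔-refl ×-↔ Finₚ.+↔⊎))

-- A structured index set lets each clause be addressed by name, while the bijection with `Fin`
-- yields the clause count.
ClauseIndex : ℕ → ℕ → Set
ClauseIndex n p = (Fin 2 × Fin n) ⊎ (Fin 2 × Cell p) ⊎ (Fin 3 × Fin 4 × Fin p) ⊎ (Fin 2 × Fin p)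

pattern edge-src e  = inj₁ (zero , e)
pattern edge-tgt e  = inj₁ (suc zero , e)
pattern cell₁₂ v    = inj₂ (inj₁ (zero , v))
pattern cell₂₁ v    = inj₂ (inj₁ (suc zero , v))
pattern pick-hi s i = inj₂ (inj₂ (inj₁ (zero , s , i)))
pattern pick-lo s i = inj₂ (inj₂ (inj₁ (suc zero , s , i)))
pattern ladder s i  = inj₂ (inj₂ (inj₁ (suc (suc zero) , s , i)))
pattern rows≠ i     = inj₂ (inj₂ (inj₂ (zero , i)))
pattern cols≠ i     = inj₂ (inj₂ (inj₂ (suc zero , i)))

clauseCount : ℕ → ℕ → ℕ
clauseCount n p = 2 * n + (2 * (p * p) + (3 * (4 * p) + 2 * p))

Fin↔ClauseIndex : Fin (clauseCount n p) ↔ ClauseIndex n p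
Fin↔ClauseIndex = ↔-trans Finₚ.+↔⊎ (Finₚ.*↔× ⊎-↔
  ↔-trans Finₚ.+↔⊎ (↔-trans Finₚ.*↔× (↔-refl ×-↔ Finₚ.*↔×) ⊎-↔
  ↔-trans Finₚ.+↔⊎ (↔-trans Finₚ.*↔× (↔-refl ×-↔ Finₚ.*↔×) ⊎-↔ Finₚ.*↔×)))

does-true : ∀ {A : Set} (a? : Dec A) → does a? ≡ true → A
does-true (yes a) _ = a

module Encoding {n p} (E : Edges n p) where
  open Edges E

  open Inverse (Fin↔Aux {p}) using ()
    renaming (to to decode; from to code; strictlyInverseˡ to decode-code)
  open Inverse (Fin↔ClauseIndex {n} {p}) using ()
    renaming (to to index; from to position; strictlyInverseˡ to index-position)

  x : Fin n → Var n (auxCount p)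
  x = inj₁

  y : Aux p → Var n (auxCount p)
  y a = inj₂ (code a)

  clause : ClauseIndex n p → Clause n (auxCount p)
  clause (edge-src e)     = neg (x e) ∷ pos (y (cell (src e))) ∷ []
  clause (edge-tgt e)     = neg (x e) ∷ pos (y (cell (tgt e))) ∷ []
  clause (cell₁₂ (r , c)) = neg (y (cell (r , c))) ∷ pos (y (pick row₁ r)) ∷ pos (y (pick col₂ c)) ∷ []
  clause (cell₂₁ (r , c)) = neg (y (cell (r , c))) ∷ pos (y (pick col₁ c)) ∷ pos (y (pick row₂ r)) ∷ []
  -- A sequential counter: a pick at `i` turns on every threshold above `i`, and a pick at `j`
  -- forbids threshold `j`; two different picks in one slot therefore clash.
  clause (pick-hi s i)    = neg (y (pick s i)) ∷ pos (y (above s (suc i))) ∷ []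
  clause (pick-lo s i)    = neg (y (pick s i)) ∷ neg (y (above s (inject₁ i))) ∷ []
  clause (ladder s i)     = neg (y (above s (inject₁ i))) ∷ pos (y (above s (suc i))) ∷ []
  clause (rows≠ i)        = neg (y (pick row₁ i)) ∷ neg (y (pick row₂ i)) ∷ []
  clause (cols≠ i)        = neg (y (pick col₁ i)) ∷ neg (y (pick col₂ i)) ∷ []

  formula : CNF n (auxCount p)
  formula = tabulate (clause ∘ index)

  size-formula : size formula ≡ clauseCount n p
  size-formula = length-tabulate (clause ∘ index)

  -- Completeness: a satisfying assignment built from a single edge.

  module Complete (τ : Fin n → Bool) (e : Fin n) (only-e : ∀ i → τ i ≡ true → i ≡ e) where

    slot : Fin 4 → Fin p
    slot row₁ = proj₁ (src e)
    slot row₂ = proj₁ (tgt e)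
    slot col₁ = proj₂ (src e)
    slot col₂ = proj₂ (tgt e)

    -- The intended truth of each variable as a decidable proposition; both ends of `e` are marked
    -- even if `e` itself is false.
    Meaning : Aux p → Set
    Meaning (cell v)    = v ≡ src e ⊎ v ≡ tgt e
    Meaning (pick s i)  = i ≡ slot s
    Meaning (above s j) = toℕ (slot s) < toℕ j

    meaning? : ∀ a → Dec (Meaning a)
    meaning? (cell v)    = ≡-dec Finₚ._≟_ Finₚ._≟_ v (src e) ⊎-dec ≡-dec Finₚ._≟_ Finₚ._≟_ v (tgt e)
    meaning? (pick s i)  = i Finₚ.≟ slot s
    meaning? (above s j) = toℕ (slot s) <? toℕ j

    σ : Fin (auxCount p) → Bool
    σ j = does (meaning? (decode j))

    α : Var n (auxCount p) → Bool
    α = assign τ σ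

    α-true : ∀ a → Meaning a → α (y a) ≡ true
    α-true a h = dec-true (meaning? (decode (code a))) (subst Meaning (sym (decode-code a)) h)

    α-meaning : ∀ a → α (y a) ≡ true → Meaning a
    α-meaning a h = subst Meaning (decode-code a) (does-true (meaning? (decode (code a))) h)

    implies : ∀ a b → (Meaning a → Meaning b) → SatClause α (neg (y a) ∷ pos (y b) ∷ [])
    implies a b f = ⇒-intro (y a) λ h → here (α-true b (f (α-meaning a h)))

    excludes : ∀ a b → (Meaning a → ¬ Meaning b) → SatClause α (neg (y a) ∷ neg (y b) ∷ [])
    excludes a b f = ⇒-intro (y a) λ h → ⇒-intro (y b) λ h′ →
      contradiction (α-meaning b h′) (f (α-meaning a h))

    satisfied : ∀ k → SatClause α (clause k)
    satisfied (edge-src i) = ⇒-intro (x i) λ h →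
      here (α-true (cell (src i)) (inj₁ (cong src (only-e i h))))
    satisfied (edge-tgt i) = ⇒-intro (x i) λ h →
      here (α-true (cell (tgt i)) (inj₂ (cong tgt (only-e i h))))
    satisfied (cell₁₂ (r , c)) = ⇒-intro (y (cell (r , c))) λ h → go (α-meaning (cell (r , c)) h)
      where
      go : Meaning (cell (r , c)) → SatClause α (pos (y (pick row₁ r)) ∷ pos (y (pick col₂ c)) ∷ [])
      go (inj₁ eq) = here (α-true (pick row₁ r) (,-injectiveˡ eq))
      go (inj₂ eq) = there (here (α-true (pick col₂ c) (,-injectiveʳ eq)))
    satisfied (cell₂₁ (r , c)) = ⇒-intro (y (cell (r , c))) λ h → go (α-meaning (cell (r , c)) h)
      where
      go : Meaning (cell (r , c)) → SatClause α (pos (y (pick col₁ c)) ∷ pos (y (pick row₂ r)) ∷ [])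
      go (inj₁ eq) = here (α-true (pick col₁ c) (,-injectiveʳ eq))
      go (inj₂ eq) = there (here (α-true (pick row₂ r) (,-injectiveˡ eq)))
    satisfied (pick-hi s i) = implies (pick s i) (above s (suc i)) λ { refl → ≤-refl }
    satisfied (pick-lo s i) = excludes (pick s i) (above s (inject₁ i))
      λ { refl → <-irrefl (sym (Finₚ.toℕ-inject₁ i)) }
    satisfied (ladder s i) = implies (above s (inject₁ i)) (above s (suc i))
      λ h → m≤n⇒m≤1+n (subst (toℕ (slot s) <_) (Finₚ.toℕ-inject₁ i) h)
    -- The guessed rows differ, and likewise the columns, because the ends of `e` do.
    satisfied (rows≠ i) = excludes (pick row₁ i) (pick row₂ i)
      λ { refl eq → <-irrefl (cong toℕ eq) (rows< e) }
    satisfied (cols≠ i) = excludes (pick col₁ i) (pick col₂ i)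
      λ { refl eq → cols≢ e eq }

    satisfies : SatCNF α formula
    satisfies = tabulate⁺ (satisfied ∘ index)

  -- Soundness: a satisfying assignment has at most one true edge.

  module Sound (α : Var n (auxCount p) → Bool) (sat : SatCNF α formula) where

    satisfied : ∀ k → SatClause α (clause k)
    satisfied k = subst (SatClause α ∘ clause) (index-position k) (tabulate⁻ sat (position k))

    True : Aux p → Set
    True a = α (y a) ≡ true

    -- Induction on `j`: `pick-hi` starts the chain at `i + 1`, and `ladder` carries it upwards.
    above-monotone : ∀ s i → True (pick s i) → ∀ j → toℕ i < toℕ j → True (above s j)
    above-monotone s i h = <-weakInduction (λ j → toℕ i < toℕ j → True (above s j)) (λ ()) step
      where
      step : ∀ j → (toℕ i < toℕ (inject₁ j) → True (above s (inject₁ j))) →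
             toℕ i < toℕ (suc j) → True (above s (suc j))
      step j ih i<1+j with i Finₚ.≟ j
      ... | yes refl = unit-pos (⇒-elim (y (pick s i)) (satisfied (pick-hi s i)) h)
      ... | no  i≢j  = unit-pos (⇒-elim (y (above s (inject₁ j))) (satisfied (ladder s j)) (ih
              (subst (toℕ i <_) (sym (Finₚ.toℕ-inject₁ j))
                (≤∧≢⇒< (s≤s⁻¹ i<1+j) (i≢j ∘ Finₚ.toℕ-injective)))))

    pick-≮ : ∀ s {i j} → True (pick s i) → True (pick s j) → ¬ i Fin.< j
    pick-≮ s {i} {j} hᵢ hⱼ i<j =
      unit-neg (y (above s (inject₁ j))) (⇒-elim (y (pick s j)) (satisfied (pick-lo s j)) hⱼ)
        (above-monotone s i hᵢ (inject₁ j) (subst (toℕ i <_) (sym (Finₚ.toℕ-inject₁ j)) i<j))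

    pick-unique : ∀ s {i j} → True (pick s i) → True (pick s j) → i ≡ j
    pick-unique s {i} {j} hᵢ hⱼ with Finₚ.<-cmp i j
    ... | tri< i<j _ _ = contradiction i<j (pick-≮ s hᵢ hⱼ)
    ... | tri≈ _ eq _  = eq
    ... | tri> _ _ j<i = contradiction j<i (pick-≮ s hⱼ hᵢ)

    First Second : Cell p → Set
    First  (r , c) = True (pick row₁ r) × True (pick col₁ c)
    Second (r , c) = True (pick row₂ r) × True (pick col₂ c)

    First-unique : ∀ {u v} → First u → First v → u ≡ v
    First-unique (r , c) (r′ , c′) = cong₂ _,_ (pick-unique row₁ r r′) (pick-unique col₁ c c′)

    Second-unique : ∀ {u v} → Second u → Second v → u ≡ v
    Second-unique (r , c) (r′ , c′) = cong₂ _,_ (pick-unique row₂ r r′) (pick-unique col₂ c c′)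

    cell-cases : ∀ v → True (cell v) → First v ⊎ Second v
    cell-cases v@(r , c) h
      with ⇒-elim (y (cell v)) (satisfied (cell₁₂ v)) h | ⇒-elim (y (cell v)) (satisfied (cell₂₁ v)) h
    ... | here r₁         | here c₁         = inj₁ (r₁ , c₁)
    ... | there (here c₂) | there (here r₂) = inj₂ (r₂ , c₂)
    ... | here r₁         | there (here r₂) = contradiction r₂
            (unit-neg (y (pick row₂ r)) (⇒-elim (y (pick row₁ r)) (satisfied (rows≠ r)) r₁))
    ... | there (here c₂) | here c₁         = contradiction c₂
            (unit-neg (y (pick col₂ c)) (⇒-elim (y (pick col₁ c)) (satisfied (cols≠ c)) c₁))

    Forward Backward : Fin n → Set
    Forward  e = First (src e) × Second (tgt e)
    Backward e = Second (src e) × First (tgt e)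

    src≢tgt : ∀ e → src e ≢ tgt e
    src≢tgt e eq = cols≢ e (cong proj₂ eq)

    -- The two ends are distinct cells, so they cannot both be the first guess or both the second.
    orientation : ∀ e → α (x e) ≡ true → Forward e ⊎ Backward e
    orientation e h
      with cell-cases (src e) (unit-pos (⇒-elim (x e) (satisfied (edge-src e)) h))
         | cell-cases (tgt e) (unit-pos (⇒-elim (x e) (satisfied (edge-tgt e)) h))
    ... | inj₁ s | inj₂ t = inj₁ (s , t)
    ... | inj₂ s | inj₁ t = inj₂ (s , t)
    ... | inj₁ s | inj₁ t = contradiction (First-unique s t) (src≢tgt e)
    ... | inj₂ s | inj₂ t = contradiction (Second-unique s t) (src≢tgt e)

    -- Uniqueness of the guesses would make `f` the reverse of `e`, and then `rows<` would order the
    -- same two rows both ways.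
    no-opposite : ∀ e f → Forward e → ¬ Backward f
    no-opposite e f (s , t) (s′ , t′) = <-asym (rows< e)
      (subst (λ v → proj₁ v Fin.< proj₁ (src e)) (Second-unique s′ t)
        (subst (λ v → proj₁ (src f) Fin.< proj₁ v) (First-unique t′ s) (rows< f)))

    edge-unique : ∀ e f → α (x e) ≡ true → α (x f) ≡ true → e ≡ f
    edge-unique e f hₑ h_f with orientation e hₑ | orientation f h_f
    ... | inj₁ (s , t) | inj₁ (s′ , t′) = injective (First-unique s s′) (Second-unique t t′)
    ... | inj₂ (s , t) | inj₂ (s′ , t′) = injective (Second-unique s s′) (First-unique t t′)
    ... | inj₁ a       | inj₂ b         = contradiction b (no-opposite e f a)
    ... | inj₂ a       | inj₁ b         = contradiction a (no-opposite f e b)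

open Encoding using (formula; size-formula)

candidate : (τ : Fin (suc n) → Bool) → AtMostOne τ → Σ (Fin (suc n)) λ e → ∀ i → τ i ≡ true → i ≡ e
candidate τ amo with Finₚ.any? (λ i → τ i Boolₚ.≟ true)
... | yes (e , h) = e , λ i h′ → amo i e h′ h
-- With all inputs false the condition is vacuous, so any default edge serves.
... | no  none    = zero , λ i h → contradiction (i , h) none

formula-encodes : (E : Edges (suc n) p) → Encodes AtMostOne (formula E)
formula-encodes E τ = complete , λ (σ , sat) → Encoding.Sound.edge-unique E (assign τ σ) sat
  where
  complete : AtMostOne τ → Σ _ λ σ → SatCNF (assign τ σ) (formula E)
  complete amo = let e , only-e = candidate τ amo in
    Encoding.Complete.σ E τ e only-e , Encoding.Complete.satisfies E τ e only-e

-- Bounds on the numbers of clauses and variables.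

module Bounds (n : ℕ) where

  -- `s` is the main term, `q` is of order the fourth root of `2 * n` and gives grid side `suc q`,
  -- and `r` measures the error.
  s q r : ℕ
  s = ceilSqrt (2 * n)
  q = ceilSqrt s
  r = ceilRoot4 n

  s≤q*q : s ≤ q * q
  s≤q*q = subst (s ≤_) (cong (q *_) (*-identityʳ q)) (ceilRoot-sound 1 s)

  -- Side `suc q` is enough because `suc q * q` already dominates `q * q`, hence `s`, and its square
  -- is twice the edge count.
  n≤edgeCount : n ≤ edgeCount q
  n≤edgeCount = *-cancelˡ-≤ 2 (begin
    2 * n            ≤⟨ ceilRoot-sound 1 (2 * n) ⟩
    s ^ 2            ≤⟨ ^-monoˡ-≤ 2 (≤-trans s≤q*q (*-monoˡ-≤ q (n≤1+n q))) ⟩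
    (suc q * q) ^ 2  ≡⟨ 2*edgeCount q ⟨
    2 * edgeCount q  ∎)
    where open ≤-Reasoning

  -- By minimality of the root it suffices that the square of `2 * r ^ 2` reaches `2 * n`; `q≤2r`
  -- repeats the argument one level down.
  s≤2r² : s ≤ 2 * r ^ 2
  s≤2r² = ceilRoot-least 2 (2 * n) (begin
    2 * n              ≤⟨ *-monoʳ-≤ 2 (ceilRoot-sound 3 n) ⟩
    2 * r ^ 4          ≤⟨ *-monoˡ-≤ (r ^ 4) (s≤s (s≤s (z≤n {2}))) ⟩
    4 * r ^ 4          ≡⟨ square r ⟨
    (2 * r ^ 2) ^ 2    ∎)
    where
    open ≤-Reasoning
    square : ∀ r → (2 * (r * (r * 1))) * ((2 * (r * (r * 1))) * 1) ≡ 4 * (r * (r * (r * (r * 1))))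
    square = solve-∀

  q≤2r : q ≤ 2 * r
  q≤2r = ceilRoot-least 2 s (begin
    s            ≤⟨ s≤2r² ⟩
    2 * r ^ 2    ≤⟨ *-monoˡ-≤ (r ^ 2) (s≤s (s≤s (z≤n {2}))) ⟩
    4 * r ^ 2    ≡⟨ square r ⟨
    (2 * r) ^ 2  ∎)
    where
    open ≤-Reasoning
    square : ∀ r → (2 * r) * ((2 * r) * 1) ≡ 4 * (r * (r * 1))
    square = solve-∀

  1≤r : 1 ≤ n → 1 ≤ r
  1≤r 1≤n = go r (ceilRoot-sound 3 n)
    where
    go : ∀ t → n ≤ t ^ 4 → 1 ≤ t
    go zero    h = ≤-trans 1≤n h
    go (suc _) _ = s≤s z≤n

  -- Since `n` is positive, `r` is at least 1 and absorbs the constant `b`; the logarithm has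
  -- exponent 0.
  linear≤softErr : ∀ a b → 1 ≤ n → a * q + b ≤ softErr (2 * a + b) 0 n
  linear≤softErr a b 1≤n = begin
    a * q + b            ≤⟨ +-mono-≤ (*-monoʳ-≤ a q≤2r) (m≤m*n b r ⦃ >-nonZero (1≤r 1≤n) ⦄) ⟩
    a * (2 * r) + b * r  ≡⟨ collect a b r ⟩
    softErr (2 * a + b) 0 n ∎
    where
    open ≤-Reasoning
    collect : ∀ a b r → a * (2 * r) + b * r ≡ (2 * a + b) * r * 1
    collect = solve-∀

  q*q≤s+2q : q * q ≤ s + 2 * q
  q*q≤s+2q = ceilSqrt-square≤ s

  clauseCount≤ : 1 ≤ n → clauseCount n (suc q) ≤ 2 * n + 2 * s + softErr 60 0 n
  clauseCount≤ 1≤n = begin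
    clauseCount n (suc q)              ≡⟨ expand n q ⟩
    2 * n + 2 * (q * q) + (18 * q + 16) ≤⟨ +-monoˡ-≤ (18 * q + 16) (+-monoʳ-≤ (2 * n) (*-monoʳ-≤ 2 q*q≤s+2q)) ⟩
    2 * n + 2 * (s + 2 * q) + (18 * q + 16) ≡⟨ collect n s q ⟩
    2 * n + 2 * s + (22 * q + 16)      ≤⟨ +-monoʳ-≤ (2 * n + 2 * s) (linear≤softErr 22 16 1≤n) ⟩
    2 * n + 2 * s + softErr 60 0 n     ∎
    where
    open ≤-Reasoning
    expand : ∀ n q → 2 * n + (2 * (suc q * suc q) + (3 * (4 * suc q) + 2 * suc q))
                     ≡ 2 * n + 2 * (q * q) + (18 * q + 16)
    expand = solve-∀
    collect : ∀ n s q → 2 * n + 2 * (s + 2 * q) + (18 * q + 16) ≡ 2 * n + 2 * s + (22 * q + 16)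
    collect = solve-∀

  auxCount≤ : 1 ≤ n → auxCount (suc q) ≤ s + softErr 60 0 n
  auxCount≤ 1≤n = begin
    auxCount (suc q)                ≡⟨ expand q ⟩
    -- Deliberately loosened towards `22 * q + 16`, the error of the clause count, so that one
    -- constant covers both bounds.
    q * q + (10 * q + 13)           ≤⟨ +-mono-≤ q*q≤s+2q (+-monoˡ-≤ 13 (*-monoˡ-≤ q (m≤m+n 10 10))) ⟩
    s + 2 * q + (20 * q + 13)       ≤⟨ +-monoʳ-≤ (s + 2 * q) (+-monoʳ-≤ (20 * q) (m≤m+n 13 3)) ⟩
    s + 2 * q + (20 * q + 16)       ≡⟨ collect s q ⟩
    s + (22 * q + 16)               ≤⟨ +-monoʳ-≤ s (linear≤softErr 22 16 1≤n) ⟩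
    s + softErr 60 0 n              ∎
    where
    open ≤-Reasoning
    expand : ∀ q → suc q * suc q + 4 * (suc q + suc (suc q)) ≡ q * q + (10 * q + 13)
    expand = solve-∀
    collect : ∀ s q → s + 2 * q + (20 * q + 16) ≡ s + (22 * q + 16)
    collect = solve-∀

theorem8 : Σ ℕ λ c → Σ ℕ λ C → Σ ℕ λ N → ∀ (n : ℕ) → N ≤ n →
    Σ ℕ λ m → Σ (CNF n m) λ φ →
    Encodes AtMostOne φ
    × size φ ≤ 2 * n + 2 * ceilSqrt (2 * n) + softErr C c n
    × m ≤ ceilSqrt (2 * n) + softErr C c n
-- No logarithmic factor arises; 60 is `2 * 22 + 16` from `linear≤softErr`, and `n ≥ 1` supplies
-- both a default edge and `r ≥ 1`.
theorem8 = 0 , 60 , 1 , λ { n@(suc _) 1≤n →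
  let open Bounds n
      E = restrict n≤edgeCount (gridEdges q)
  in auxCount (suc q) , formula E , formula-encodes E ,
     subst (_≤ 2 * n + 2 * s + softErr 60 0 n) (sym (size-formula E)) (clauseCount≤ 1≤n) ,
     auxCount≤ 1≤n }
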